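{- Let $G$ and $H$ be graphs. The join $G+H$ is a hangable graph if and only if either (1) $G+H$ is a complete graph, or (2) at most one vertex of $G+H$ is adjacent to every other vertex of $G+H$.
   Context: All graphs are finite, simple, undirected, with nonempty vertex set. For a connected graph $G=(V_G,E_G)$, $d_G(u,v)$ is the length of a shortest $u$--$v$ path. The eccentricity of $v$ is $e_G(v)=\max\{d_G(v,u): u\in V_G\}$ and the diameter is $d(G)=\max\{e_G(v): v\in V_G\}$. The periphery of a vertex $v$ is $P_G(v)=\{u\in V_G: d_G(v,u)=e_G(v)\}$; the periphery of $G$ is $P(G)=\{v\in V_G: e_G(v)=d(G)\}$. A connected graph $G$ is hangable if $P_G(v)\subseteq P(G)$ for every $v\in V_G$. The join $G+H$ is the graph obtained from the disjoint union of $G$ and $H$ by adding an edge between each vertex of $G$ and each vertex of $H$. -}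

module Defs where

open import Data.Fin using (Fin)
open import Data.Fin.Properties using (+↔⊎)
open import Data.List using (List; []; _∷_)
open import Data.List.Relation.Unary.Unique.Propositional using (Unique)
open import Data.Nat using (ℕ; zero; suc; _+_; _≤_)
open import Data.Product using (Σ-syntax; ∃-syntax; _×_; proj₁)
open import Data.Sum using (_⊎_; inj₁; inj₂)
open import Data.Sum.Function.Propositional using (_⊎-↔_)
open import Function using (_↔_; _∘_)
open import Function.Construct.Composition using (_↔-∘_)
open import Function.Construct.Symmetry using (↔-sym)
open import Level using (0ℓ)
open import Relation.Binary.Core using (Rel)
open import Relation.Binary.Construct.Closure.ReflexiveTransitive using (Star; ε; _◅_)
open import Relation.Binary.Definitions using (Decidable; Irreflexive; Symmetric)
open import Relation.Binary.PropositionalEquality using (_≡_; _≢_; refl)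
open import Relation.Nullary using (yes; no)

-- Adjacency is required to be decidable, which is automatic classically;
-- decidable equality of vertices follows from finiteness.
record Graph : Set₁ where
  field
    V        : Set
    order    : ℕ
    finite   : V ↔ Fin order
    nonempty : V
    Adj      : Rel V 0ℓ
    adj?     : Decidable Adj
    irrefl   : Irreflexive _≡_ Adj
    sym      : Symmetric Adj

module _ (G : Graph) where
  open Graph G

  Walk : V → V → Set
  Walk = Star Adj

  vertices : ∀ {u v} → Walk u v → List V
  vertices {u} ε       = u ∷ []
  vertices {u} (_ ◅ w) = u ∷ vertices w

  Path : V → V → Set
  Path u v = Σ[ w ∈ Walk u v ] Unique (vertices w)

  walkLength : ∀ {u v} → Walk u v → ℕ
  walkLength ε       = zero
  walkLength (_ ◅ w) = suc (walkLength w)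

  pathLength : ∀ {u v} → Path u v → ℕ
  pathLength = walkLength ∘ proj₁

  Connected : Set
  Connected = ∀ u v → Path u v

  -- Distance, eccentricity and diameter are given by their graphs as
  -- relations: each determines its last argument uniquely, and in a
  -- connected graph such a value always exists.

  IsDistance : V → V → ℕ → Set
  IsDistance u v k =
    (Σ[ p ∈ Path u v ] pathLength p ≡ k) × (∀ (p : Path u v) → k ≤ pathLength p)

  IsEccentricity : V → ℕ → Set
  IsEccentricity v e =
    (∃[ u ] IsDistance v u e) × (∀ u k → IsDistance v u k → k ≤ e)

  IsDiameter : ℕ → Set
  IsDiameter d =
    (∃[ v ] IsEccentricity v d) × (∀ v e → IsEccentricity v e → e ≤ d)

  _∈PeripheryOf_ : V → V → Set
  u ∈PeripheryOf v = ∃[ k ] (IsDistance v u k × IsEccentricity v k)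

  InPeriphery : V → Set
  InPeriphery v = ∃[ k ] (IsEccentricity v k × IsDiameter k)

  Hangable : Set
  Hangable = Connected × (∀ v u → u ∈PeripheryOf v → InPeriphery u)

  Complete : Set
  Complete = ∀ u v → u ≢ v → Adj u v

  AdjacentToAllOthers : V → Set
  AdjacentToAllOthers v = ∀ u → u ≢ v → Adj v u

  AtMostOneAdjacentToAllOthers : Set
  AtMostOneAdjacentToAllOthers =
    ∀ u v → AdjacentToAllOthers u → AdjacentToAllOthers v → u ≡ v

module _ (G H : Graph) where
  private
    module G = Graph G
    module H = Graph H

  data JoinAdj : Rel (G.V ⊎ H.V) 0ℓ where
    left        : ∀ {u v} → G.Adj u v → JoinAdj (inj₁ u) (inj₁ v)
    right       : ∀ {u v} → H.Adj u v → JoinAdj (inj₂ u) (inj₂ v)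
    left-right  : ∀ {u v} → JoinAdj (inj₁ u) (inj₂ v)
    right-left  : ∀ {u v} → JoinAdj (inj₂ u) (inj₁ v)

  joinAdj? : Decidable JoinAdj
  joinAdj? (inj₁ u) (inj₁ v) with G.adj? u v
  ... | yes a = yes (left a)
  ... | no ¬a = no λ { (left a) → ¬a a }
  joinAdj? (inj₂ u) (inj₂ v) with H.adj? u v
  ... | yes a = yes (right a)
  ... | no ¬a = no λ { (right a) → ¬a a }
  joinAdj? (inj₁ _) (inj₂ _) = yes left-right
  joinAdj? (inj₂ _) (inj₁ _) = yes right-left

  joinIrrefl : Irreflexive _≡_ JoinAdj
  joinIrrefl refl (left a)  = G.irrefl refl a
  joinIrrefl refl (right a) = H.irrefl refl a

  joinSym : Symmetric JoinAdj
  joinSym (left a)   = left (G.sym a)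
  joinSym (right a)  = right (H.sym a)
  joinSym left-right = right-left
  joinSym right-left = left-right

infixl 6 _⋈_

-- The join, written G + H on paper.
_⋈_ : Graph → Graph → Graph
G ⋈ H = record
  { V        = G.V ⊎ H.V
  ; order    = G.order + H.order
  ; finite   = ↔-sym +↔⊎ ↔-∘ (G.finite ⊎-↔ H.finite)
  ; nonempty = inj₁ G.nonempty
  ; Adj      = JoinAdj G H
  ; adj?     = joinAdj? G H
  ; irrefl   = joinIrrefl G H
  ; sym      = joinSym G H
  }
  where
    module G = Graph G
    module H = Graph H

{-# OPTIONS --safe #-}
module Submission where

open import Data.Empty using (⊥-elim)
open import Data.Fin.Properties using (all?; ¬∀⟶∃¬; inj⇒≟)
open import Data.List.Relation.Unary.All using ([]; _∷_)
open import Data.List.Relation.Unary.AllPairs using ([]; _∷_)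
open import Data.Nat using (_≤_; z≤n; s≤s)
open import Data.Nat.Properties using (≤-antisym; 1+n≰n)
open import Data.Product using (∃-syntax; _×_; _,_; proj₁; proj₂)
open import Data.Sum using (_⊎_; inj₁; inj₂; [_,_]′)
open import Function.Base using (_∘_)
open import Function.Bundles using (_⇔_; mk⇔; Inverse)
open import Function.Properties.Inverse using (↔⇒↣)
open import Level using (0ℓ)
open import Relation.Binary.Construct.Closure.ReflexiveTransitive using (ε; _◅_)
open import Relation.Binary.Definitions using (DecidableEquality)
open import Relation.Binary.PropositionalEquality
  using (_≡_; _≢_; refl; subst; ≢-sym)
open import Relation.Nullary using (¬_; yes; no)
open import Relation.Nullary.Decidable using (_→-dec_; ¬?; decidable-stable)
open import Relation.Unary using (Pred; Decidable)
open import Defs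

-- A join has at least two vertices, and any two non-adjacent vertices have a
-- common neighbour. Hence a vertex has eccentricity 1 or 2 according to
-- whether it is adjacent to all others. If the join is not complete, its
-- diameter is 2 and its periphery is the set of vertices that are not adjacent
-- to all others; a vertex u adjacent to all others is in the periphery of
-- some v exactly when there is a second such vertex v.

module _ (K : Graph) where
  open Graph K renaming (sym to adj-sym)

  vertex-≟ : DecidableEquality V
  vertex-≟ = inj⇒≟ (↔⇒↣ finite)

  -- Finiteness stands in for excluded middle: transporting `P` to `Fin order` makes an exhaustive
  -- search possible.
  all⊎counterexample : {P : Pred V 0ℓ} → Decidable P → (∀ v → P v) ⊎ (∃[ v ] ¬ P v)
  all⊎counterexample {P} P? with all? (P? ∘ Inverse.from finite)
  ... | yes h = inj₁ λ v → subst P (Inverse.strictlyInverseʳ finite v) (h (Inverse.to finite v))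
  ... | no ¬h with ¬∀⟶∃¬ order (P ∘ Inverse.from finite) (P? ∘ Inverse.from finite) ¬h
  ...   | i , ¬p = inj₂ (Inverse.from finite i , ¬p)

  adjacentToAllOthers? : Decidable (AdjacentToAllOthers K)
  adjacentToAllOthers? v
    with all⊎counterexample (λ u → ¬? (vertex-≟ u v) →-dec adj? v u)
  ... | inj₁ h        = yes h
  ... | inj₂ (u , ¬h) = no λ h → ¬h (h u)

  nonNeighbour : ∀ {v} → ¬ AdjacentToAllOthers K v → ∃[ u ] (u ≢ v × ¬ Adj v u)
  nonNeighbour {v} ¬univ
    with all⊎counterexample (λ u → ¬? (vertex-≟ u v) →-dec adj? v u)
  ... | inj₁ h        = ⊥-elim (¬univ h)
  -- The implication `u ≢ v → Adj v u` fails at `u`: equality would make it vacuous, adjacency would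
  -- make it true.
  ... | inj₂ (u , ¬h) = u , (λ u≡v → ¬h λ u≢v → ⊥-elim (u≢v u≡v)) , (λ a → ¬h λ _ → a)

  -- Each minimal path bounds the other's length. As distance is a relation, this lets any given
  -- value be compared with an explicitly computed one.
  distance-unique : ∀ {u v j k} → IsDistance K u v j → IsDistance K u v k → j ≡ k
  distance-unique ((p , refl) , p-min) ((q , refl) , q-min) = ≤-antisym (p-min q) (q-min p)

  eccentricity-unique : ∀ {v j k} → IsEccentricity K v j → IsEccentricity K v k → j ≡ k
  eccentricity-unique ((u , du) , u-max) ((w , dw) , w-max) =
    ≤-antisym (w-max u _ du) (u-max w _ dw)

  distance-self : ∀ {u} → IsDistance K u u 0
  distance-self = ((ε , [] ∷ []) , refl) , λ _ → z≤n

  distance-adjacent : ∀ {u v} → Adj u v → IsDistance K u v 1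
  distance-adjacent a =
    ((a ◅ ε , ((λ e → irrefl e a) ∷ []) ∷ [] ∷ []) , refl) , λ where
      (ε , _)     → ⊥-elim (irrefl refl a)
      (_ ◅ _ , _) → s≤s z≤n

  distance-commonNeighbour : ∀ {u v w} → u ≢ v → ¬ Adj u v → Adj u w → Adj w v →
    IsDistance K u v 2
  distance-commonNeighbour u≢v ¬uv uw wv =
    ((uw ◅ wv ◅ ε , ((λ e → irrefl e uw) ∷ u≢v ∷ []) ∷ ((λ e → irrefl e wv) ∷ []) ∷ [] ∷ [])
    , refl) , λ where
      (ε , _)         → ⊥-elim (u≢v refl)
      (a ◅ ε , _)     → ⊥-elim (¬uv a)
      (_ ◅ _ ◅ _ , _) → s≤s (s≤s z≤n)

  module _ (another : ∀ (v : V) → ∃[ u ] u ≢ v)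
           (commonNeighbour : ∀ u v → ¬ Adj u v → ∃[ w ] (Adj u w × Adj w v)) where

    distance-two : ∀ {u v} → u ≢ v → ¬ Adj u v → IsDistance K u v 2
    distance-two {u} {v} u≢v ¬uv with commonNeighbour u v ¬uv
    ... | w , uw , wv = distance-commonNeighbour u≢v ¬uv uw wv

    distance≤2 : ∀ u v → ∃[ k ] (IsDistance K u v k × k ≤ 2)
    distance≤2 u v with vertex-≟ u v
    ... | yes refl = 0 , distance-self , z≤n
    ... | no u≢v with adj? u v
    ...   | yes a  = 1 , distance-adjacent a , s≤s z≤n
    ...   | no ¬uv = 2 , distance-two u≢v ¬uv , s≤s (s≤s z≤n)

    isDistance⇒≤2 : ∀ u v k → IsDistance K u v k → k ≤ 2
    isDistance⇒≤2 u v k d with distance≤2 u v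
    ... | j , dj , j≤2 = subst (_≤ 2) (distance-unique dj d) j≤2

    connected : Connected K
    -- The projections pick out the path that realises the distance.
    connected u v = proj₁ (proj₁ (proj₁ (proj₂ (distance≤2 u v))))

    -- A second vertex rules out eccentricity 0; from `v`, only the distances 0 and 1 occur.
    eccentricity-one : ∀ {v} → AdjacentToAllOthers K v → IsEccentricity K v 1
    eccentricity-one {v} univ with another v
    ... | u , u≢v = (u , distance-adjacent (univ u u≢v)) , bound
      where
      bound : ∀ w k → IsDistance K v w k → k ≤ 1
      bound w k d with vertex-≟ w v
      ... | yes refl = subst (_≤ 1) (distance-unique distance-self d) z≤n
      ... | no w≢v   =
        subst (_≤ 1) (distance-unique (distance-adjacent (univ w w≢v)) d) (s≤s z≤n)

    eccentricity-two : ∀ {v} → ¬ AdjacentToAllOthers K v → IsEccentricity K v 2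
    eccentricity-two {v} ¬univ with nonNeighbour ¬univ
    ... | u , u≢v , ¬vu = (u , distance-two (≢-sym u≢v) ¬vu) , isDistance⇒≤2 v

    inPeriphery-complete : Complete K → ∀ u → InPeriphery K u
    inPeriphery-complete complete u =
      1 , ecc u , (u , ecc u) , λ where
        v e ecc-v → subst (_≤ 1) (eccentricity-unique (ecc v) ecc-v) (s≤s z≤n)
      where
      ecc : ∀ v → IsEccentricity K v 1
      ecc v = eccentricity-one λ w w≢v → complete v w (≢-sym w≢v)

    -- No distance exceeds 2, and `u` itself attains this bound, so it also witnesses that the
    -- diameter is 2.
    inPeriphery-nonuniversal : ∀ {u} → ¬ AdjacentToAllOthers K u → InPeriphery K u
    inPeriphery-nonuniversal {u} ¬univ =
      2 , eccentricity-two ¬univ , (u , eccentricity-two ¬univ) , λ where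
        v e ((w , d) , _) → isDistance⇒≤2 v w e d

    -- Suppose `u` is adjacent to all others. If `u` is `v`, their distance 0 falls short of the
    -- eccentricity 1. Otherwise the distance is 1, but `v` cannot also be adjacent to all others,
    -- so its eccentricity is 2.
    peripheryOf⇒nonuniversal : AtMostOneAdjacentToAllOthers K →
      ∀ {u v} → _∈PeripheryOf_ K u v → ¬ AdjacentToAllOthers K u
    peripheryOf⇒nonuniversal atMostOne {u} {v} (_ , d , ecc) univ with vertex-≟ u v
    ... | yes refl
      with refl ← distance-unique d distance-self
      with () ← eccentricity-unique ecc (eccentricity-one univ)
    ... | no u≢v
      with refl ← distance-unique d (distance-adjacent (adj-sym (univ v (≢-sym u≢v))))
      with () ← eccentricity-unique ecc (eccentricity-two (u≢v ∘ atMostOne u v univ))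

    hangable⇒ : Hangable K → Complete K ⊎ AtMostOneAdjacentToAllOthers K
    hangable⇒ (_ , hang) with all⊎counterexample adjacentToAllOthers?
    ... | inj₁ univ        = inj₁ λ u v u≢v → univ u v (≢-sym u≢v)
    ... | inj₂ (x , ¬univ) = inj₂ atMostOne
      where
      atMostOne : AtMostOneAdjacentToAllOthers K
      -- If `u` and `v` differ, then `u` is at distance 1, the eccentricity of `v`, so hangability
      -- puts `u` in the periphery of the graph. The diameter is then the eccentricity 1 of `u`,
      -- while `x` has eccentricity 2.
      atMostOne u v univ-u univ-v = decidable-stable (vertex-≟ u v) λ u≢v →
        let k , ecc-u , _ , diam-max =
              hang v u (1 , distance-adjacent (univ-v u u≢v) , eccentricity-one univ-v)
            k≡1 = eccentricity-unique ecc-u (eccentricity-one univ-u)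
        in 1+n≰n (subst (2 ≤_) k≡1 (diam-max x 2 (eccentricity-two ¬univ)))

    hangable⇔ : Hangable K ⇔ (Complete K ⊎ AtMostOneAdjacentToAllOthers K)
    hangable⇔ = mk⇔ hangable⇒ [ complete⇒ , atMostOne⇒ ]′
      where
      complete⇒ : Complete K → Hangable K
      complete⇒ complete = connected , λ _ u _ → inPeriphery-complete complete u

      atMostOne⇒ : AtMostOneAdjacentToAllOthers K → Hangable K
      atMostOne⇒ atMostOne =
        connected , λ _ _ → inPeriphery-nonuniversal ∘ peripheryOf⇒nonuniversal atMostOne

module _ (G H : Graph) where
  open Graph (G ⋈ H)

  join-another : ∀ (v : V) → ∃[ u ] u ≢ v
  join-another (inj₁ _) = inj₂ (Graph.nonempty H) , λ ()
  join-another (inj₂ _) = inj₁ (Graph.nonempty G) , λ ()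

  -- Non-adjacent vertices lie on the same side of the join, and any vertex of the other side is
  -- adjacent to both.
  join-commonNeighbour : ∀ u v → ¬ Adj u v → ∃[ w ] (Adj u w × Adj w v)
  join-commonNeighbour (inj₁ _) (inj₁ _) _   = inj₂ (Graph.nonempty H) , left-right , right-left
  join-commonNeighbour (inj₂ _) (inj₂ _) _   = inj₁ (Graph.nonempty G) , right-left , left-right
  join-commonNeighbour (inj₁ _) (inj₂ _) ¬uv = ⊥-elim (¬uv left-right)
  join-commonNeighbour (inj₂ _) (inj₁ _) ¬uv = ⊥-elim (¬uv right-left)

theorem4 : (G H : Graph) →
    Hangable (G ⋈ H) ⇔ (Complete (G ⋈ H) ⊎ AtMostOneAdjacentToAllOthers (G ⋈ H))
theorem4 G H = hangable⇔ (G ⋈ H) (join-another G H) (join-commonNeighbour G H)
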